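{- Let $G$ be a graph with a perfect ordering $\{B_1,\dots,B_k\}$ of its prime components, and let $f:\mathbb{R}\to\mathbb{R}$ satisfy $f(0)=0$. Define $s:=\max_{i}|S_i|$, where $S_i:=(B_1\cup\dots\cup B_{i-1})\cap B_i$. If $f[-]$ preserves positivity on $\mathcal{P}_{G_{B_i}}$ for all $1\le i\le k$ and is Loewner super-additive on $\mathcal{P}_{K_s}$, then $f[-]$ preserves positivity on $\mathcal{P}_G$.
   Context: Graphs are finite and simple; $G_U$ is the subgraph induced on $U$; $K_s$ is the complete graph on $s$ vertices. A decomposition of $G=(V,E)$ is a partition $(A,C,B)$ of $V$ with $A,B$ nonempty such that every path from $A$ to $B$ meets $C$ and $G_C$ is complete; $G$ is prime if it admits no decomposition. Decomposing $G$ into $G_{A\cup C}$ and $G_{B\cup C}$ and iterating until no further decomposition is possible yields the prime components of $G$ (vertex subsets inducing prime graphs). For subsets $B_1,\dots,B_k$, with $H_j=B_1\cup\dots\cup B_j$, $H_0=\emptyset$, $S_j=H_{j-1}\cap B_j$, the sequence is a perfect ordering if for every $1<i\le k$ there is $j<i$ with $S_i\subset B_j$, and each $S_i$ induces a complete graph. For a graph $H$ on $\{1,\dots,n\}$, $\mathcal{P}_H$ is the set of real symmetric PSD $n\times n$ matrices $M$ with $m_{ij}=0$ for $i\ne j$ non-adjacent. $f[M]:=(f(m_{ij}))$; $f[-]$ preserves positivity on $\mathcal{P}_H$ if $f[M]\in\mathcal{P}_H$ for all $M\in\mathcal{P}_H$; it is Loewner super-additive on $\mathcal{P}_H$ if $f[M+N]-f[M]-f[N]\in\mathcal{P}_H$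 for all $M,N\in\mathcal{P}_H$. -}

module Defs where

open import Algebra.Bundles using (CommutativeRing)
import Algebra.Properties.CommutativeMonoid.Sum as Sum
open import Data.Fin.Base using (Fin; zero; suc; toℕ; _<_)
open import Data.Fin.Properties using (_≟_)
open import Data.Fin.Subset
  using (Subset; inside; outside; _∈_; _⊆_; _∪_; _∩_; ⊤; ⋃; ∣_∣; Nonempty; Empty)
open import Data.List.Base using (List; []; _∷_; _++_; head; last; map; tabulate; take)
open import Data.List.Extrema.Nat using (max)
open import Data.List.Membership.Propositional using () renaming (_∈_ to _∈ₗ_)
open import Data.List.Relation.Unary.Any using (Any)
open import Data.List.Relation.Unary.Linked using (Linked)
open import Data.List.Relation.Unary.Unique.Propositional using (Unique)
open import Data.Maybe.Base using (just)
open import Data.Nat.Base as ℕ using (ℕ)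
open import Data.Product.Base using (∃; _×_)
open import Data.Vec.Base using ([]; _∷_)
open import Data.Vec.Functional using (Vector)
open import Function.Base using (_on_)
open import Function.Bundles using (Func; _⇔_)
open import Function.Definitions using (Injective)
open import Level using (Level; _⊔_) renaming (suc to lsuc; zero to 0ℓ)
open import Relation.Binary.Core using (Rel)
open import Relation.Binary.Definitions using (Decidable; Symmetric; Irreflexive)
open import Relation.Binary.PropositionalEquality.Core using (_≡_; _≢_; refl; ≢-sym)
open import Relation.Binary.Structures using (IsDecTotalOrder)
open import Relation.Nullary.Decidable.Core using (¬?)
open import Relation.Nullary.Negation.Core using (¬_)
open import Relation.Unary using (Pred; Satisfiable)

------------------------------------------------------------------------
-- The real numbers

-- ℝ enters through its classical characterisation, unique up to
-- isomorphism: a Dedekind-complete ordered field.  The order is decidable,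
-- as it is classically; `sup` ranges over arbitrary subsets.
record CompleteOrderedField (c ℓ₁ ℓ₂ : Level) : Set (lsuc (c ⊔ ℓ₁ ⊔ ℓ₂)) where
  infix 4 _≤_
  field
    commutativeRing : CommutativeRing c ℓ₁

  open CommutativeRing commutativeRing public

  field
    _≤_             : Rel Carrier ℓ₂
    isDecTotalOrder : IsDecTotalOrder _≈_ _≤_
    0≉1             : 0# ≉ 1#
    inverse         : ∀ x → x ≉ 0# → ∃ λ y → x * y ≈ 1#
    +-monoˡ-≤       : ∀ {x y} z → x ≤ y → x + z ≤ y + z
    *-nonNeg        : ∀ {x y} → 0# ≤ x → 0# ≤ y → 0# ≤ x * y

  UpperBound : Pred Carrier (c ⊔ ℓ₁ ⊔ ℓ₂) → Carrier → Set (c ⊔ ℓ₁ ⊔ ℓ₂)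
  UpperBound P b = ∀ x → P x → x ≤ b

  field
    sup : (P : Pred Carrier (c ⊔ ℓ₁ ⊔ ℓ₂)) → Satisfiable P → Satisfiable (UpperBound P) →
          ∃ λ s → UpperBound P s × (∀ b → UpperBound P b → s ≤ b)

------------------------------------------------------------------------
-- Graphs on {1,…,n}

record Graph (n : ℕ) : Set₁ where
  field
    Adj    : Rel (Fin n) 0ℓ
    adj?   : Decidable Adj
    sym    : Symmetric Adj
    irrefl : Irreflexive _≡_ Adj

open Graph using (Adj)

Complete : ∀ {n} → Graph n → Set
Complete G = ∀ i j → i ≢ j → Adj G i j

K : ∀ s → Graph s
K s = record
  { Adj    = _≢_
  ; adj?   = λ i j → ¬? (i ≟ j)
  ; sym    = ≢-sym
  ; irrefl = λ i≡j i≢j → i≢j i≡j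
  }

-- The increasing enumeration of the elements of U; it identifies U with
-- {1,…,|U|}, which is the vertex set used for the induced subgraph G [ U ].
enum : ∀ {n} (U : Subset n) → Fin ∣ U ∣ → Fin n
enum (outside ∷ U) i       = suc (enum U i)
enum (inside  ∷ U) zero    = zero
enum (inside  ∷ U) (suc i) = suc (enum U i)

infix 25 _[_]ᴳ

_[_]ᴳ : ∀ {n} → Graph n → (U : Subset n) → Graph ∣ U ∣
G [ U ]ᴳ = record
  { Adj    = Adj G on enum U
  ; adj?   = λ i j → Graph.adj? G (enum U i) (enum U j)
  ; sym    = Graph.sym G
  ; irrefl = λ { refl → Graph.irrefl G refl }
  }

-- The image of W under `enum U`.
image : ∀ {n} (U : Subset n) → Subset ∣ U ∣ → Subset n
image []            []      = []
image (outside ∷ U) W       = outside ∷ image U W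
image (inside  ∷ U) (w ∷ W) = w ∷ image U W

record Path {n} (G : Graph n) (u v : Fin n) : Set where
  field
    vertices : List (Fin n)
    start    : head vertices ≡ just u
    end      : last vertices ≡ just v
    linked   : Linked (Adj G) vertices
    distinct : Unique vertices

record Decomposition {n} (G : Graph n) (A C B : Subset n) : Set where
  field
    cover      : A ∪ C ∪ B ≡ ⊤
    A∩C-empty  : Empty (A ∩ C)
    A∩B-empty  : Empty (A ∩ B)
    C∩B-empty  : Empty (C ∩ B)
    A-nonempty : Nonempty A
    B-nonempty : Nonempty B
    separates  : ∀ {u v} → u ∈ A → v ∈ B → (p : Path G u v) → Any (_∈ C) (Path.vertices p)
    C-complete : Complete (G [ C ]ᴳ)

Prime : ∀ {n} → Graph n → Set
Prime {n} G = ¬ ∃ λ A → ∃ λ C → ∃ λ B → Decomposition G A C B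

-- `Components G L`: L lists the vertex sets left at the end of some complete
-- run of the iterated decomposition of G.  The pieces G [ A ∪ C ]ᴳ and
-- G [ B ∪ C ]ᴳ are renumbered, so their components are carried back to
-- vertex sets of G by `image`.
data Components {n} (G : Graph n) : List (Subset n) → Set where
  prime : Prime G → Components G (⊤ ∷ [])
  split : ∀ {A C B L L′} → Decomposition G A C B →
          Components (G [ A ∪ C ]ᴳ) L → Components (G [ B ∪ C ]ᴳ) L′ →
          Components G (map (image (A ∪ C)) L ++ map (image (B ∪ C)) L′)

-- B₁,…,Bₖ lists, without repetition, the set of prime components of G.
EnumeratesPrimeComponents : ∀ {n k} → Graph n → Vector (Subset n) k → Set
EnumeratesPrimeComponents {n} G B = ∃ λ (L : List (Subset n)) →
  Components G L × Injective _≡_ _≡_ B × (∀ U → U ∈ₗ L ⇔ (∃ λ i → B i ≡ U))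

H : ∀ {n k} → Vector (Subset n) k → ℕ → Subset n
H B j = ⋃ (take j (tabulate B))

-- Indices start from zero, so `toℕ i` is one less than the usual index of
-- B i, and `H B (toℕ i)` is the union of the sets strictly before B i.
S : ∀ {n k} → Vector (Subset n) k → Fin k → Subset n
S B i = H B (toℕ i) ∩ B i

record PerfectOrdering {n k} (G : Graph n) (B : Vector (Subset n) k) : Set where
  field
    runningIntersection : ∀ i → 0 ℕ.< toℕ i → ∃ λ j → j < i × S B i ⊆ B j
    S-complete          : ∀ i → Complete (G [ S B i ]ᴳ)

maxSeparatorSize : ∀ {n k} → Vector (Subset n) k → ℕ
maxSeparatorSize B = max 0 (tabulate λ i → ∣ S B i ∣)

------------------------------------------------------------------------
-- Entrywise functions on the cones 𝒫_H

module Entrywise {c ℓ₁ ℓ₂} (ℝ : CompleteOrderedField c ℓ₁ ℓ₂) where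

  open CompleteOrderedField ℝ
  open Sum +-commutativeMonoid using (sum)

  RealFunction : Set (c ⊔ ℓ₁)
  RealFunction = Func setoid setoid

  Matrix : ℕ → Set c
  Matrix n = Fin n → Fin n → Carrier

  record 𝒫 {n} (G : Graph n) (M : Matrix n) : Set (c ⊔ ℓ₁ ⊔ ℓ₂) where
    field
      symmetric : ∀ i j → M i j ≈ M j i
      psd       : ∀ (x : Vector Carrier n) → 0# ≤ sum λ i → sum λ j → x i * M i j * x j
      sparse    : ∀ i j → i ≢ j → ¬ Adj G i j → M i j ≈ 0#

  infix 30 _[_]

  _[_] : ∀ {n} → RealFunction → Matrix n → Matrix n
  (f [ M ]) i j = Func.to f (M i j)

  infixl 6 _⊞_ _⊟_

  _⊞_ _⊟_ : ∀ {n} → Matrix n → Matrix n → Matrix n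
  (M ⊞ N) i j = M i j + N i j
  (M ⊟ N) i j = M i j - N i j

  PreservesPositivity : ∀ {n} → RealFunction → Graph n → Set (c ⊔ ℓ₁ ⊔ ℓ₂)
  PreservesPositivity f G = ∀ M → 𝒫 G M → 𝒫 G (f [ M ])

  SuperAdditive : ∀ {n} → RealFunction → Graph n → Set (c ⊔ ℓ₁ ⊔ ℓ₂)
  SuperAdditive f G = ∀ M N → 𝒫 G M → 𝒫 G N → 𝒫 G (f [ M ⊞ N ] ⊟ f [ M ] ⊟ f [ N ])

{-# OPTIONS --safe #-}

-- Induction along the perfect ordering: with U = H_{i-1} and V = B_i, no edge joins U ∖ V to
-- V ∖ U, because by the running intersection property a pair contained in some B_l and in H_i
-- is already contained in some B_j with j ≤ i.  Symmetric Gaussian elimination at the vertices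
-- of U ∖ V (a Schur complement, without inverting the possibly singular block) writes a matrix
-- M of the cone of G_{U ∪ V} as M₁ + M₂, with M₁ in the cone of G_U and M₂ in that of G_V;
-- completeness of G on U ∩ V makes the fill-in harmless.  Then
--   f[M] = f[M₁] + f[M₂] + (f[M₁ + M₂] - f[M₁] - f[M₂]),
-- where the last summand vanishes off U ∩ V and is PSD by superadditivity.
module Submission where

open import Defs
open import Data.Nat.Base using (ℕ)
open import Data.Fin.Base using (Fin)
open import Data.Fin.Subset using (Subset)
open import Data.Vec.Functional using (Vector)
open import Function.Bundles using (Func)

open import Data.Fin.Base using (zero; suc; toℕ; fromℕ<) renaming (_<_ to _<ᶠ_)
open import Data.Fin.Induction using (<-wellFounded)
open import Data.Fin.Properties using (toℕ<n; toℕ-fromℕ<; toℕ-injective; suc-injective)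
open import Data.Fin.Subset using (inside; outside; _∈_; _∉_; _⊆_; _∪_; _∩_; ⊤; ∣_∣)
open import Data.Fin.Subset.Properties
  using (∉⊥; ∈⊤; _∈?_; ∣p∣≤n; ∣⊤∣≡n; x∈p∩q⁺; x∈p∪q⁺; x∈p∪q⁻)
open import Data.List.Base using (List; []; _∷_; allFin; filter; map; tabulate)
open import Data.List.Extrema.Nat using (max≤v⁺; xs≤max)
open import Data.List.Membership.Propositional using () renaming (_∈_ to _∈ₗ_)
open import Data.List.Membership.Propositional.Properties
  using (∈-++⁺ˡ; ∈-++⁺ʳ; ∈-allFin; ∈-filter⁺; ∈-filter⁻; ∈-map⁺)
import Data.List.Relation.Unary.All as All
import Data.List.Relation.Unary.All.Properties as All
open import Data.List.Relation.Unary.AllPairs using ([]; _∷_)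
open import Data.List.Relation.Unary.Any using (here; there)
open import Data.List.Relation.Unary.Linked using ([-]; _∷_)
import Data.Nat.Base as ℕ
open import Data.Nat.Base using (z≤n; s≤s)
import Data.Nat.Properties as ℕ
open import Data.Product.Base using (∃; _×_; _,_; proj₁; proj₂)
open import Data.Sum.Base using (_⊎_; inj₁; inj₂; [_,_])
open import Data.Vec.Base using ([]; _∷_; here; there)
open import Function.Base using (_∘_; id)
open import Function.Bundles using (Equivalence)
open import Induction.WellFounded using (Acc; acc)
open import Level using (_⊔_)
open import Relation.Binary.PropositionalEquality as ≡ using (_≡_; _≢_)
open import Relation.Binary.Structures using (IsDecTotalOrder)
open import Relation.Nullary.Decidable using (Dec; yes; no; ¬?; _×-dec_)
open import Relation.Nullary.Negation using (¬_; contradiction)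

open Graph using (Adj)

-- Vertex subsets and their enumerations.

enum-injective : ∀ {n} (U : Subset n) {i j} → enum U i ≡ enum U j → i ≡ j
enum-injective (outside ∷ U)                 eq = enum-injective U (suc-injective eq)
enum-injective (inside  ∷ U) {zero}  {zero}  eq = ≡.refl
enum-injective (inside  ∷ U) {suc i} {suc j} eq =
  ≡.cong suc (enum-injective U (suc-injective eq))

enum-surjective : ∀ {n} (U : Subset n) {u} → u ∈ U → ∃ λ i → enum U i ≡ u
enum-surjective (inside  ∷ U) here      = zero , ≡.refl
enum-surjective (outside ∷ U) (there p) with i , eq ← enum-surjective U p = i , ≡.cong suc eq
enum-surjective (inside  ∷ U) (there p) with i , eq ← enum-surjective U p = suc i , ≡.cong suc eq

∈-image : ∀ {n} (U : Subset n) {W i} → i ∈ W → enum U i ∈ image U W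
∈-image (outside ∷ U) p                         = there (∈-image U p)
∈-image (inside  ∷ U) {_ ∷ _} here              = here
∈-image (inside  ∷ U) {_ ∷ _} {suc i} (there p) = there (∈-image U p)

Complete⇒Adj : ∀ {n} (G : Graph n) (U : Subset n) → Complete (G [ U ]ᴳ) →
               ∀ {u v} → u ∈ U → v ∈ U → u ≢ v → Adj G u v
Complete⇒Adj G U cpl u∈U v∈U u≢v with enum-surjective U u∈U | enum-surjective U v∈U
... | i , ≡.refl | j , ≡.refl = cpl i j (u≢v ∘ ≡.cong (enum U))

-- Superadditivity is assumed at the single order s, while an individual separator may be smaller.
-- Enlarging it to exactly s vertices makes that hypothesis applicable.
superset : ∀ {n} (U : Subset n) {s} → ∣ U ∣ ℕ.≤ s → s ℕ.≤ n → ∃ λ V → U ⊆ V × ∣ V ∣ ≡ s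
superset []           {ℕ.zero}  _        _ = [] , id , ≡.refl
superset (inside ∷ U) {ℕ.suc s} (s≤s le) (s≤s s≤n) with V , U⊆V , eq ← superset U le s≤n =
  inside ∷ V , (λ { here → here ; (there p) → there (U⊆V p) }) , ≡.cong ℕ.suc eq
superset (outside ∷ U) {s} le s≤n with s ℕ.≤? _
... | yes s≤n′ with V , U⊆V , eq ← superset U le s≤n′ =
  outside ∷ V , (λ { (there p) → there (U⊆V p) }) , eq
-- The first vertex can be left out only if the remaining n suffice. Otherwise s is n + 1, and the
-- full set is the only choice.
superset {ℕ.suc n} (outside ∷ U) {s} le s≤n | no s≰n′ =
  ⊤ , (λ _ → ∈⊤) , ≡.trans (∣⊤∣≡n (ℕ.suc n)) (ℕ.≤-antisym (ℕ.≰⇒> s≰n′) s≤n)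

-- Prime components cover all vertices and edges.

EqualOrAdjacent : ∀ {n} → Graph n → Fin n → Fin n → Set
EqualOrAdjacent G u v = u ≡ v ⊎ Adj G u v

module _ {n} {G : Graph n} {A C B : Subset n} (dec : Decomposition G A C B) where
  open Decomposition dec

  -- An edge is a path whose only vertices are its ends, so one of the ends would have to lie in C,
  -- which is disjoint from both A and B.
  A-B-separated : ∀ {u v} → u ∈ A → v ∈ B → ¬ EqualOrAdjacent G u v
  A-B-separated u∈A v∈B (inj₁ ≡.refl) = A∩B-empty (_ , x∈p∩q⁺ (u∈A , v∈B))
  A-B-separated {u} {v} u∈A v∈B (inj₂ uv) with separates u∈A v∈B edge
    where
    edge : Path G u v
    edge = record
      { vertices = u ∷ v ∷ []
      ; start    = ≡.refl
      ; end      = ≡.refl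
      ; linked   = uv ∷ [-]
      ; distinct = ((λ u≡v → Graph.irrefl G u≡v uv) All.∷ All.[]) ∷ All.[] ∷ []
      }
  ... | here u∈C         = A∩C-empty (_ , x∈p∩q⁺ (u∈A , u∈C))
  ... | there (here v∈C) = C∩B-empty (_ , x∈p∩q⁺ (v∈C , v∈B))

  -- Only a pair with one end in A and the other in B would fit in neither piece, and separation
  -- rules it out.
  same-piece : ∀ {u v} → EqualOrAdjacent G u v →
               (u ∈ A ∪ C × v ∈ A ∪ C) ⊎ (u ∈ B ∪ C × v ∈ B ∪ C)
  same-piece {u} {v} uv with class u | class v
    where
    class : ∀ w → w ∈ A ⊎ (w ∈ C ⊎ w ∈ B)
    class w with x∈p∪q⁻ A (C ∪ B) (≡.subst (w ∈_) (≡.sym cover) ∈⊤)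
    ... | inj₁ w∈A   = inj₁ w∈A
    ... | inj₂ w∈C∪B = inj₂ (x∈p∪q⁻ C B w∈C∪B)
  ... | inj₁ a        | inj₁ a′        = inj₁ (x∈p∪q⁺ (inj₁ a) , x∈p∪q⁺ (inj₁ a′))
  ... | inj₁ a        | inj₂ (inj₁ c)  = inj₁ (x∈p∪q⁺ (inj₁ a) , x∈p∪q⁺ (inj₂ c))
  ... | inj₁ a        | inj₂ (inj₂ b)  = contradiction uv (A-B-separated a b)
  ... | inj₂ (inj₁ c) | inj₁ a         = inj₁ (x∈p∪q⁺ (inj₂ c) , x∈p∪q⁺ (inj₁ a))
  ... | inj₂ (inj₁ c) | inj₂ (inj₁ c′) = inj₁ (x∈p∪q⁺ (inj₂ c) , x∈p∪q⁺ (inj₂ c′))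
  ... | inj₂ (inj₁ c) | inj₂ (inj₂ b)  = inj₂ (x∈p∪q⁺ (inj₂ c) , x∈p∪q⁺ (inj₁ b))
  ... | inj₂ (inj₂ b) | inj₁ a         =
    contradiction ([ inj₁ ∘ ≡.sym , inj₂ ∘ Graph.sym G ] uv) (A-B-separated a b)
  ... | inj₂ (inj₂ b) | inj₂ (inj₁ c)  = inj₂ (x∈p∪q⁺ (inj₁ b) , x∈p∪q⁺ (inj₂ c))
  ... | inj₂ (inj₂ b) | inj₂ (inj₂ b′) = inj₂ (x∈p∪q⁺ (inj₁ b) , x∈p∪q⁺ (inj₁ b′))

Covers : ∀ {n} → Graph n → List (Subset n) → Set
Covers G L = ∀ {u v} → EqualOrAdjacent G u v → ∃ λ U → U ∈ₗ L × u ∈ U × v ∈ U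

image-covers : ∀ {n} (G : Graph n) (U : Subset n) {L} → Covers (G [ U ]ᴳ) L →
               ∀ {u v} → u ∈ U → v ∈ U → EqualOrAdjacent G u v →
               ∃ λ V → V ∈ₗ map (image U) L × u ∈ V × v ∈ V
image-covers G U cov u∈U v∈U uv with enum-surjective U u∈U | enum-surjective U v∈U
... | i , ≡.refl | j , ≡.refl with cov ([ inj₁ ∘ enum-injective U , inj₂ ] uv)
...   | W , W∈L , i∈W , j∈W =
  image U W , ∈-map⁺ (image U) W∈L , ∈-image U i∈W , ∈-image U j∈W

-- No split loses an edge or a vertex, since each lies inside one of the two pieces. It therefore
-- survives down to a leaf of the run.
components-cover : ∀ {n} {G : Graph n} {L} → Components G L → Covers G L
components-cover (prime _) _ = ⊤ , here ≡.refl , ∈⊤ , ∈⊤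
components-cover {G = G} (split {A} {C} {B} {L} {L′} dec cA cB) uv with same-piece dec uv
... | inj₁ (u∈ , v∈)
  with V , V∈ , p ← image-covers G (A ∪ C) (components-cover cA) u∈ v∈ uv = V , ∈-++⁺ˡ V∈ , p
... | inj₂ (u∈ , v∈)
  with V , V∈ , p ← image-covers G (B ∪ C) (components-cover cB) u∈ v∈ uv =
  V , ∈-++⁺ʳ (map (image (A ∪ C)) L) V∈ , p

-- Unions of components and the running intersection property.

∈-H⁺ : ∀ {n k} (B : Vector (Subset n) k) {m} l {u} → toℕ l ℕ.< m → u ∈ B l → u ∈ H B m
∈-H⁺ B {ℕ.suc m} zero    _         u∈ = x∈p∪q⁺ (inj₁ u∈)
∈-H⁺ B {ℕ.suc m} (suc l) (s≤s l<m) u∈ = x∈p∪q⁺ (inj₂ (∈-H⁺ (B ∘ suc) l l<m u∈))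

∈-H⁻ : ∀ {n k} (B : Vector (Subset n) k) m {u} → u ∈ H B m → ∃ λ l → toℕ l ℕ.< m × u ∈ B l
∈-H⁻ {k = ℕ.zero}  B ℕ.zero    u∈ = contradiction u∈ ∉⊥
∈-H⁻ {k = ℕ.suc k} B ℕ.zero    u∈ = contradiction u∈ ∉⊥
∈-H⁻ {k = ℕ.zero}  B (ℕ.suc m) u∈ = contradiction u∈ ∉⊥
∈-H⁻ {k = ℕ.suc k} B (ℕ.suc m) u∈ with x∈p∪q⁻ (B zero) (H (B ∘ suc) m) u∈
... | inj₁ u∈₀ = zero , s≤s z≤n , u∈₀
... | inj₂ u∈′ with l , l<m , u∈l ← ∈-H⁻ (B ∘ suc) m u∈′ = suc l , s≤s l<m , u∈l

H-mono : ∀ {n k} (B : Vector (Subset n) k) {m m′} → m ℕ.≤ m′ → H B m ⊆ H B m′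
H-mono B {m} m≤m′ u∈ with l , l<m , u∈l ← ∈-H⁻ B m u∈ = ∈-H⁺ B l (ℕ.≤-trans l<m m≤m′) u∈l

H-suc : ∀ {n k} (B : Vector (Subset n) k) i → H B (ℕ.suc (toℕ i)) ⊆ H B (toℕ i) ∪ B i
H-suc B i u∈ with ∈-H⁻ B (ℕ.suc (toℕ i)) u∈
... | l , s≤s l≤i , u∈l with toℕ l ℕ.≟ toℕ i
...   | yes eq  = x∈p∪q⁺ (inj₂ (≡.subst (λ l → _ ∈ B l) (toℕ-injective eq) u∈l))
...   | no  neq = x∈p∪q⁺ (inj₁ (∈-H⁺ B l (ℕ.≤∧≢⇒< l≤i neq) u∈l))

∣S∣≤maxSeparatorSize : ∀ {n k} (B : Vector (Subset n) k) i → ∣ S B i ∣ ℕ.≤ maxSeparatorSize B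
∣S∣≤maxSeparatorSize B i = All.tabulate⁻ (xs≤max 0 (tabulate λ i → ∣ S B i ∣)) i

maxSeparatorSize≤n : ∀ {n k} (B : Vector (Subset n) k) → maxSeparatorSize B ℕ.≤ n
maxSeparatorSize≤n B = max≤v⁺ z≤n (All.tabulate⁺ λ i → ∣p∣≤n (S B i))

module _ {n k} {G : Graph n} {B : Vector (Subset n) k} (po : PerfectOrdering G B) where
  open PerfectOrdering po

  -- If l is at least m, both points lie in `H B m`, hence in `H B l`, hence in `S B l`. Running
  -- intersection then places them in a common set of smaller index, and the descent stops below m.
  common-member-descends : ∀ {u v} m → u ∈ H B m → v ∈ H B m → ∀ l → u ∈ B l → v ∈ B l →
                           ∃ λ j → toℕ j ℕ.< m × u ∈ B j × v ∈ B j
  common-member-descends {u} {v} m u∈H v∈H l = go l (<-wellFounded l)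
    where
    -- Running intersection is available only at positive indices. A point of `H B m` shows that m,
    -- and so every l not below m, is positive.
    0<m : 0 ℕ.< m
    0<m with l , l<m , _ ← ∈-H⁻ B m u∈H = ℕ.≤-trans (s≤s z≤n) l<m

    go : ∀ l → Acc _<ᶠ_ l → u ∈ B l → v ∈ B l → ∃ λ j → toℕ j ℕ.< m × u ∈ B j × v ∈ B j
    go l (acc rec) u∈ v∈ with toℕ l ℕ.<? m
    ... | yes l<m = l , l<m , u∈ , v∈
    ... | no  l≮m with m≤l ← ℕ.≮⇒≥ l≮m
                  with j , j<l , S⊆Bj ← runningIntersection l (ℕ.≤-trans 0<m m≤l) =
      go j (rec j<l) (S⊆Bj (x∈p∩q⁺ (H-mono B m≤l u∈H , u∈)))
                     (S⊆Bj (x∈p∩q⁺ (H-mono B m≤l v∈H , v∈)))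

  -- An edge from u to v would lie in some `B l`, and by descent in some `B j` with j at most i. The
  -- case j = i puts u in `B i`, and j < i puts v in the earlier union.
  S-separates : (∀ {u v} → Adj G u v → ∃ λ l → u ∈ B l × v ∈ B l) → ∀ i {u v} →
                u ∈ H B (toℕ i) → u ∉ B i → v ∈ B i → v ∉ H B (toℕ i) → ¬ Adj G u v
  S-separates edge i u∈H u∉B v∈B v∉H uv
    with l , u∈l , v∈l ← edge uv
    with common-member-descends (ℕ.suc (toℕ i)) (H-mono B (ℕ.n≤1+n _) u∈H)
           (∈-H⁺ B i ℕ.≤-refl v∈B) l u∈l v∈l
  ... | j , s≤s j≤i , u∈j , v∈j with toℕ j ℕ.≟ toℕ i
  ...   | yes eq  = u∉B (≡.subst (λ j → _ ∈ B j) (toℕ-injective eq) u∈j)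
  ...   | no  neq = v∉H (∈-H⁺ B j (ℕ.≤∧≢⇒< j≤i neq) v∈j)

module _ {c ℓ₁ ℓ₂} (ℝ : CompleteOrderedField c ℓ₁ ℓ₂) where

  open CompleteOrderedField ℝ hiding (zero)
  open Entrywise ℝ
  open IsDecTotalOrder isDecTotalOrder
    using (antisym; total)
    renaming (trans to ≤-trans; reflexive to ≤-reflexive; _≟_ to _≈?_)
  open import Algebra.Properties.Semiring.Sum semiring
    using (sum; ∑-distrib-+; ∑-comm; *-distribˡ-sum) renaming (sum-cong-≋ to sum-cong)
  open import Algebra.Properties.Ring ring using (-‿distribʳ-*; -‿distribˡ-*; -0#≈0#)
  open import Algebra.Properties.Group +-group using (⁻¹-involutive)
  open import Algebra.Solver.Ring.NaturalCoefficients.Default commutativeSemiring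
    using (solve; _:=_; _:+_; _:*_)
  open import Relation.Binary.Reasoning.Setoid setoid

  -- Order facts and finite sums in the reals.

  0≤-resp-≈ : ∀ {x y} → x ≈ y → 0# ≤ x → 0# ≤ y
  0≤-resp-≈ x≈y 0≤x = ≤-trans 0≤x (≤-reflexive x≈y)

  +-nonNeg : ∀ {x y} → 0# ≤ x → 0# ≤ y → 0# ≤ x + y
  +-nonNeg {x} {y} 0≤x 0≤y =
    ≤-trans 0≤y (≤-trans (≤-reflexive (sym (+-identityˡ y))) (+-monoˡ-≤ y 0≤x))

  square-nonNeg : ∀ x → 0# ≤ x * x
  square-nonNeg x with total 0# x
  ... | inj₁ 0≤x = *-nonNeg 0≤x 0≤x
  ... | inj₂ x≤0 = 0≤-resp-≈ -x*-x≈x*x (*-nonNeg 0≤-x 0≤-x)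
    where
    0≤-x : 0# ≤ - x
    0≤-x = ≤-trans (≤-reflexive (sym (-‿inverseʳ x)))
                   (≤-trans (+-monoˡ-≤ (- x) x≤0) (≤-reflexive (+-identityˡ _)))
    -x*-x≈x*x : - x * - x ≈ x * x
    -x*-x≈x*x = begin
      - x * - x      ≈⟨ -‿distribˡ-* x (- x) ⟨
      - (x * - x)    ≈⟨ -‿cong (-‿distribʳ-* x x) ⟨
      - - (x * x)    ≈⟨ ⁻¹-involutive (x * x) ⟩
      x * x          ∎

  0≤1 : 0# ≤ 1#
  0≤1 = 0≤-resp-≈ (*-identityˡ 1#) (square-nonNeg 1#)

  x+1≈0⇒0≰x : ∀ {x} → x + 1# ≈ 0# → ¬ 0# ≤ x
  x+1≈0⇒0≰x {x} x+1≈0 0≤x = 0≉1 (antisym 0≤1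
    (≤-trans (≤-reflexive (sym (+-identityˡ 1#)))
             (≤-trans (+-monoˡ-≤ 1# 0≤x) (≤-reflexive x+1≈0))))

  sum-zero : ∀ {n} {g : Vector Carrier n} → (∀ i → g i ≈ 0#) → sum g ≈ 0#
  sum-zero {ℕ.zero}  g≈0 = refl
  sum-zero {ℕ.suc n} g≈0 = trans (+-cong (g≈0 zero) (sum-zero (g≈0 ∘ suc))) (+-identityˡ 0#)

  sum-split : ∀ {n} {h : Vector Carrier n} f g → (∀ i → h i ≈ f i + g i) → sum h ≈ sum f + sum g
  sum-split f g h≈f+g = trans (sum-cong h≈f+g) (∑-distrib-+ f g)

  sum-enum : ∀ {n} (U : Subset n) (g : Vector Carrier n) → (∀ i → i ∉ U → g i ≈ 0#) →
             sum g ≈ sum (g ∘ enum U)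
  sum-enum []            g g≈0 = refl
  sum-enum (outside ∷ U) g g≈0 =
    trans (+-cong (g≈0 zero λ ()) (sum-enum U (g ∘ suc) λ i i∉ → g≈0 (suc i) λ { (there p) → i∉ p }))
          (+-identityˡ _)
  sum-enum (inside ∷ U)  g g≈0 =
    +-congˡ (sum-enum U (g ∘ suc) λ i i∉ → g≈0 (suc i) λ { (there p) → i∉ p })

  unit : ∀ {n} → Fin n → Vector Carrier n
  unit zero    zero    = 1#
  unit zero    (suc _) = 0#
  unit (suc a) zero    = 0#
  unit (suc a) (suc i) = unit a i

  sum-unit : ∀ {n} (a : Fin n) (g : Vector Carrier n) → sum (λ i → unit a i * g i) ≈ g a
  sum-unit zero    g =
    trans (+-cong (*-identityˡ _) (sum-zero λ i → zeroˡ (g (suc i)))) (+-identityʳ _)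
  sum-unit (suc a) g = trans (+-cong (zeroˡ _) (sum-unit a (g ∘ suc))) (+-identityˡ _)

  -- Quadratic forms and positive semidefinite matrices.

  bilinear : ∀ {n} → Matrix n → Vector Carrier n → Vector Carrier n → Carrier
  bilinear M x y = sum λ i → sum λ j → x i * M i j * y j

  quadratic : ∀ {n} → Matrix n → Vector Carrier n → Carrier
  quadratic M x = bilinear M x x

  Symm PSD : ∀ {n} → Matrix n → Set _
  Symm M = ∀ i j → M i j ≈ M j i
  PSD M = ∀ x → 0# ≤ quadratic M x

  -- Only rows are constrained. For a symmetric matrix the columns outside U then vanish as well.
  Supp : ∀ {n} → Subset n → Matrix n → Set _
  Supp U M = ∀ i j → i ∉ U → M i j ≈ 0#

  infix 4 _≋_
  _≋_ : ∀ {n} → Matrix n → Matrix n → Set _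
  M ≋ N = ∀ i j → M i j ≈ N i j

  quadratic-cong : ∀ {n} {M N : Matrix n} → M ≋ N → ∀ x → quadratic M x ≈ quadratic N x
  quadratic-cong M≋N x = sum-cong λ i → sum-cong λ j → *-congʳ (*-congˡ (M≋N i j))

  quadratic-⊞ : ∀ {n} (M N : Matrix n) x →
                quadratic (M ⊞ N) x ≈ quadratic M x + quadratic N x
  quadratic-⊞ M N x =
    sum-split (λ i → sum λ j → x i * M i j * x j) (λ i → sum λ j → x i * N i j * x j) λ i →
    sum-split (λ j → x i * M i j * x j) (λ j → x i * N i j * x j) λ j →
    trans (*-congʳ (distribˡ _ _ _)) (distribʳ _ _ _)

  PSD-resp-≋ : ∀ {n} {M N : Matrix n} → M ≋ N → PSD M → PSD N
  PSD-resp-≋ M≋N psd x = 0≤-resp-≈ (quadratic-cong M≋N x) (psd x)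

  PSD-⊞ : ∀ {n} {M N : Matrix n} → PSD M → PSD N → PSD (M ⊞ N)
  PSD-⊞ {M = M} {N} psdM psdN x =
    0≤-resp-≈ (sym (quadratic-⊞ M N x)) (+-nonNeg (psdM x) (psdN x))

  PSD-zero : ∀ {n} {M : Matrix n} → (∀ i j → M i j ≈ 0#) → PSD M
  PSD-zero M≈0 x = ≤-reflexive (sym (sum-zero λ i → sum-zero λ j →
    trans (*-congʳ (trans (*-congˡ (M≈0 i j)) (zeroʳ _))) (zeroˡ _)))

  bilinear-comm : ∀ {n} {M : Matrix n} → Symm M → ∀ x y → bilinear M x y ≈ bilinear M y x
  bilinear-comm {M = M} symM x y = trans (∑-comm λ i j → x i * M i j * y j)
    (sum-cong λ j → sum-cong λ i → trans
      (solve 3 (λ x m y → x :* m :* y := y :* m :* x) refl (x i) (M i j) (y j))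
      (*-congʳ (*-congˡ (symM i j))))

  bilinear-+ˡ : ∀ {n} (M : Matrix n) x x′ y →
                bilinear M (λ i → x i + x′ i) y ≈ bilinear M x y + bilinear M x′ y
  bilinear-+ˡ M x x′ y =
    sum-split (λ i → sum λ j → x i * M i j * y j) (λ i → sum λ j → x′ i * M i j * y j) λ i →
    sum-split (λ j → x i * M i j * y j) (λ j → x′ i * M i j * y j) λ j →
    trans (*-congʳ (distribʳ _ _ _)) (distribʳ _ _ _)

  infix 8 _∙ᵛ_
  _∙ᵛ_ : ∀ {n} → Vector Carrier n → Vector Carrier n → Carrier
  u ∙ᵛ y = sum λ j → u j * y j

  bilinear-unitˡ : ∀ {n} (M : Matrix n) t a y →
                   bilinear M (λ i → t * unit a i) y ≈ t * (M a ∙ᵛ y)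
  bilinear-unitˡ M t a y = begin
    (sum λ i → sum λ j → t * unit a i * M i j * y j)   ≈⟨ sum-cong row ⟩
    (sum λ i → unit a i * (t * (M i ∙ᵛ y)))            ≈⟨ sum-unit a (λ i → t * (M i ∙ᵛ y)) ⟩
    t * (M a ∙ᵛ y)                                     ∎
    where
    row : ∀ i → (sum λ j → t * unit a i * M i j * y j) ≈ unit a i * (t * (M i ∙ᵛ y))
    row i = begin
      (sum λ j → t * unit a i * M i j * y j)       ≈⟨ sum-cong (λ j → *-assoc _ (M i j) (y j)) ⟩
      (sum λ j → t * unit a i * (M i j * y j))     ≈⟨ *-distribˡ-sum _ (λ j → M i j * y j) ⟨
      t * unit a i * (M i ∙ᵛ y)
        ≈⟨ solve 3 (λ t u w → t :* u :* w := u :* (t :* w)) refl t (unit a i) (M i ∙ᵛ y) ⟩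
      unit a i * (t * (M i ∙ᵛ y))                  ∎

  quadratic-unit : ∀ {n} (M : Matrix n) t a → quadratic M (λ i → t * unit a i) ≈ t * (t * M a a)
  quadratic-unit M t a = trans (bilinear-unitˡ M t a λ i → t * unit a i) (*-congˡ (trans
    (sum-cong λ j → solve 3 (λ m t e → m :* (t :* e) := e :* (t :* m)) refl (M a j) t (unit a j))
    (sum-unit a λ j → t * M a j)))

  -- This is the form on the line through x in the direction of the unit vector at a, as a
  -- polynomial in t. The factor `M a ∙ᵛ x` is the entry of Mx at a.
  quadratic-shift : ∀ {n} {M : Matrix n} → Symm M → ∀ x t a →
    quadratic M (λ i → x i + t * unit a i) ≈
    quadratic M x + (t * (M a ∙ᵛ x) + t * (M a ∙ᵛ x)) + t * (t * M a a)
  quadratic-shift {M = M} symM x t a = begin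
    bilinear M x+u x+u                                  ≈⟨ bilinear-+ˡ M x u x+u ⟩
    bilinear M x x+u + bilinear M u x+u
      ≈⟨ +-cong (expandʳ x) (expandʳ u) ⟩
    (quadratic M x + bilinear M u x) + (bilinear M u x + bilinear M u u)
      ≈⟨ +-cong (+-congˡ ux) (+-cong ux (quadratic-unit M t a)) ⟩
    (quadratic M x + tw) + (tw + t * (t * M a a))
      ≈⟨ solve 3 (λ q w m → (q :+ w) :+ (w :+ m) := q :+ (w :+ w) :+ m) refl _ tw _ ⟩
    quadratic M x + (tw + tw) + t * (t * M a a)          ∎
    where
    u x+u : Vector Carrier _
    u i = t * unit a i
    x+u i = x i + u i
    tw : Carrier
    tw = t * (M a ∙ᵛ x)
    expandʳ : ∀ y → bilinear M y x+u ≈ bilinear M y x + bilinear M u y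
    expandʳ y = begin
      bilinear M y x+u                  ≈⟨ bilinear-comm symM y x+u ⟩
      bilinear M x+u y                  ≈⟨ bilinear-+ˡ M x u y ⟩
      bilinear M x y + bilinear M u y   ≈⟨ +-congʳ (bilinear-comm symM x y) ⟩
      bilinear M y x + bilinear M u y   ∎
    ux : bilinear M u x ≈ tw
    ux = bilinear-unitˡ M t a x

  quadratic-shift-nonNeg : ∀ {n} {M : Matrix n} → Symm M → PSD M → ∀ x t a →
    0# ≤ quadratic M x + (t * (M a ∙ᵛ x) + t * (M a ∙ᵛ x)) + t * (t * M a a)
  quadratic-shift-nonNeg symM psdM x t a = 0≤-resp-≈ (quadratic-shift symM x t a) (psdM _)

  -- When the diagonal entry at a vanishes, the form at e_j + t e_a is affine in t with slope twice
  -- `M a j`. A nonzero slope would let it become negative.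
  zero-diagonal⇒zero-row : ∀ {n} {M : Matrix n} → Symm M → PSD M → ∀ a →
                           M a a ≈ 0# → ∀ j → M a j ≈ 0#
  zero-diagonal⇒zero-row {M = M} symM psdM a Maa≈0 j with M a j ≈? 0#
  ... | yes Maj≈0 = Maj≈0
  ... | no  Maj≉0 with r , Maj*r≈1 ← inverse (M a j) Maj≉0 =
    contradiction (+-nonNeg 0≤m+2z (+-nonNeg 0≤m 0≤1)) (x+1≈0⇒0≰x vanishes)
    where
    m z t w : Carrier
    m = quadratic M (λ i → 1# * unit j i)
    -- Here t is chosen so that t times `M a j` equals z. The form then takes the value m + 2z = -m
    -- - 2, which is negative because m is nonnegative.
    z = - (m + 1#)
    t = z * r
    w = M a ∙ᵛ (λ i → 1# * unit j i)

    0≤m : 0# ≤ m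
    0≤m = psdM _

    w≈Maj : w ≈ M a j
    w≈Maj = trans (sum-cong {y = λ i → unit j i * M a i} λ i → trans (*-congˡ (*-identityˡ _)) (*-comm _ _))
                  (sum-unit j (M a))

    tw≈z : t * w ≈ z
    tw≈z = begin
      z * r * w          ≈⟨ *-congˡ w≈Maj ⟩
      z * r * M a j      ≈⟨ *-assoc z r (M a j) ⟩
      z * (r * M a j)    ≈⟨ *-congˡ (trans (*-comm r (M a j)) Maj*r≈1) ⟩
      z * 1#             ≈⟨ *-identityʳ z ⟩
      z                  ∎

    0≤m+2z : 0# ≤ m + (z + z)
    0≤m+2z = 0≤-resp-≈
      (trans (+-cong (+-congˡ (+-cong tw≈z tw≈z))
                     (trans (*-congˡ (trans (*-congˡ Maa≈0) (zeroʳ t))) (zeroʳ t)))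
             (+-identityʳ _))
      (quadratic-shift-nonNeg symM psdM _ t a)

    vanishes : m + (z + z) + (m + 1#) + 1# ≈ 0#
    vanishes = begin
      m + (z + z) + (m + 1#) + 1#
        ≈⟨ solve 3 (λ m z o → m :+ (z :+ z) :+ (m :+ o) :+ o := (m :+ o :+ z) :+ (m :+ o :+ z))
                 refl m z 1# ⟩
      (m + 1# + z) + (m + 1# + z)      ≈⟨ +-cong (-‿inverseʳ _) (-‿inverseʳ _) ⟩
      0# + 0#                          ≈⟨ +-identityˡ 0# ⟩
      0#                               ∎

  -- Rank-one matrices and symmetric pivoting.

  rankOne : ∀ {n} → Carrier → Vector Carrier n → Matrix n
  rankOne c u i j = c * (u i * u j)

  rankOne-symm : ∀ {n} c (u : Vector Carrier n) → Symm (rankOne c u)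
  rankOne-symm c u i j = *-congˡ (*-comm (u i) (u j))

  quadratic-rankOne : ∀ {n} c (u : Vector Carrier n) x →
                      quadratic (rankOne c u) x ≈ c * ((u ∙ᵛ x) * (u ∙ᵛ x))
  quadratic-rankOne c u x = begin
    (sum λ i → sum λ j → x i * (c * (u i * u j)) * x j)  ≈⟨ sum-cong row ⟩
    (sum λ i → c * w * (u i * x i))          ≈⟨ *-distribˡ-sum (c * w) (λ i → u i * x i) ⟨
    c * w * w                                ≈⟨ *-assoc c w w ⟩
    c * (w * w)                              ∎
    where
    w : Carrier
    w = u ∙ᵛ x
    row : ∀ i → (sum λ j → x i * (c * (u i * u j)) * x j) ≈ c * w * (u i * x i)
    row i = begin
      (sum λ j → x i * (c * (u i * u j)) * x j)
        ≈⟨ sum-cong (λ j → solve 5 (λ xi c ui uj xj →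
             xi :* (c :* (ui :* uj)) :* xj := xi :* c :* ui :* (uj :* xj))
             refl (x i) c (u i) (u j) (x j)) ⟩
      (sum λ j → x i * c * u i * (u j * x j))  ≈⟨ *-distribˡ-sum _ (λ j → u j * x j) ⟨
      x i * c * u i * w
        ≈⟨ solve 4 (λ xi c ui w → xi :* c :* ui :* w := c :* w :* (ui :* xi))
                 refl (x i) c (u i) w ⟩
      c * w * (u i * x i)                      ∎

  rankOne-PSD : ∀ {n} {c} (u : Vector Carrier n) → 0# ≤ c → PSD (rankOne c u)
  rankOne-PSD u 0≤c x =
    0≤-resp-≈ (sym (quadratic-rankOne _ u x)) (*-nonNeg 0≤c (square-nonNeg (u ∙ᵛ x)))

  -- With c the inverse of `M a a` this is the Schur complement at a, kept at order n with row a
  -- equal to zero.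
  residual : ∀ {n} → Carrier → Fin n → Matrix n → Matrix n
  residual c a M = M ⊞ rankOne (- c) (M a)

  residual-symm : ∀ {n} c a {M : Matrix n} → Symm M → Symm (residual c a M)
  residual-symm c a {M} symM i j = +-cong (symM i j) (rankOne-symm (- c) (M a) i j)

  -- The fill-in at (i, j) is a multiple of `M a i * M a j`, so a zero entry can be spoiled only if
  -- both factors are nonzero.
  residual-zero : ∀ {n} c a (M : Matrix n) {i j} → M i j ≈ 0# → M a i * M a j ≈ 0# →
                  residual c a M i j ≈ 0#
  residual-zero c a M Mij≈0 uu≈0 =
    trans (+-cong Mij≈0 (trans (*-congˡ uu≈0) (zeroʳ _))) (+-identityˡ 0#)

  rankOne⊞residual : ∀ {n} c a (M : Matrix n) → M ≋ rankOne c (M a) ⊞ residual c a M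
  rankOne⊞residual c a M i j = sym (begin
    c * p + (M i j + - c * p)   ≈⟨ solve 4 (λ c e p m → c :* p :+ (m :+ e :* p) := (c :+ e) :* p :+ m)
                                         refl c (- c) p (M i j) ⟩
    (c + - c) * p + M i j       ≈⟨ +-congʳ (trans (*-congʳ (-‿inverseʳ c)) (zeroˡ p)) ⟩
    0# + M i j                  ≈⟨ +-identityˡ _ ⟩
    M i j                       ∎)
    where
    p : Carrier
    p = M a i * M a j

  -- c is the inverse of the pivot M a a, or 0 when the pivot, and hence its row, vanishes.
  pivot : ∀ {n} {M : Matrix n} → Symm M → PSD M → ∀ a →
          ∃ λ c → 0# ≤ c × PSD (residual c a M) × (∀ j → residual c a M a j ≈ 0#)
  pivot {M = M} symM psdM a with M a a ≈? 0#
  ... | yes Maa≈0 = 0# , ≤-reflexive refl , PSD-resp-≋ M≋residual psdM ,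
                    λ j → trans (sym (M≋residual a j)) (row≈0 j)
    where
    row≈0 : ∀ j → M a j ≈ 0#
    row≈0 = zero-diagonal⇒zero-row symM psdM a Maa≈0
    M≋residual : M ≋ residual 0# a M
    M≋residual i j = sym (trans
      (+-congˡ (trans (*-congʳ -0#≈0#) (zeroˡ _))) (+-identityʳ _))
  ... | no  Maa≉0 with c , Maa*c≈1 ← inverse (M a a) Maa≉0 = c , 0≤c , residual-PSD , row≈0
    where
    e : Carrier
    e = - c

    c*Maa≈1 : c * M a a ≈ 1#
    c*Maa≈1 = trans (*-comm c (M a a)) Maa*c≈1

    0≤c : 0# ≤ c
    -- The form at c e_a has the value c (c `M a a`) = c.
    0≤c = 0≤-resp-≈
      (trans (quadratic-unit M c a) (trans (*-congˡ c*Maa≈1) (*-identityʳ c))) (psdM _)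

    1+eMaa≈0 : 1# + e * M a a ≈ 0#
    1+eMaa≈0 = trans (+-cong (sym c*Maa≈1) (sym (-‿distribˡ-* c (M a a)))) (-‿inverseʳ _)

    row≈0 : ∀ j → residual c a M a j ≈ 0#
    row≈0 j = begin
      M a j + e * (M a a * M a j)
        ≈⟨ +-cong (sym (*-identityˡ _)) (sym (*-assoc e (M a a) (M a j))) ⟩
      1# * M a j + e * M a a * M a j    ≈⟨ distribʳ _ _ _ ⟨
      (1# + e * M a a) * M a j          ≈⟨ *-congʳ 1+eMaa≈0 ⟩
      0# * M a j                        ≈⟨ zeroˡ _ ⟩
      0#                                ∎

    -- Completing the square: moving x along e_a by t = -c (Mx)_a reaches the minimum of the form of
    -- M on that line, and this minimum is the form of the residual at x.
    residual-PSD : PSD (residual c a M)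
    residual-PSD x = 0≤-resp-≈ (begin
      q + (t * w + t * w) + t * (t * M a a)
        ≈⟨ +-congʳ (+-congˡ (+-congʳ (sym (*-identityˡ _)))) ⟩
      q + (1# * (t * w) + t * w) + t * (t * M a a)
        ≈⟨ solve 5 (λ q e w m o →
             q :+ (o :* (e :* w :* w) :+ e :* w :* w) :+ e :* w :* (e :* w :* m) :=
             (o :+ e :* m) :* (e :* w :* w) :+ (q :+ e :* (w :* w)))
             refl q e w (M a a) 1# ⟩
      (1# + e * M a a) * (e * w * w) + (q + e * (w * w))
        ≈⟨ +-congʳ (trans (*-congʳ 1+eMaa≈0) (zeroˡ _)) ⟩
      0# + (q + e * (w * w))            ≈⟨ +-identityˡ _ ⟩
      q + e * (w * w)                   ≈⟨ +-congˡ (quadratic-rankOne e (M a) x) ⟨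
      q + quadratic (rankOne e (M a)) x ≈⟨ quadratic-⊞ M (rankOne e (M a)) x ⟨
      quadratic (residual c a M) x      ∎)
      (quadratic-shift-nonNeg symM psdM x t a)
      where
      q w t : Carrier
      q = quadratic M x
      w = M a ∙ᵛ x
      t = e * w

  -- Splitting a matrix by elimination.

  -- No graph occurs here; sparsity of the two summands is recovered later from their supports. The
  -- field `zero-row₂` ensures that rows cleared by earlier pivots stay cleared.
  record Splitting {n} (U : Subset n) (M : Matrix n) : Set (c ⊔ ℓ₁ ⊔ ℓ₂) where
    field
      M₁ M₂         : Matrix n
      M≋M₁⊞M₂       : M ≋ M₁ ⊞ M₂
      symm₁         : Symm M₁
      symm₂         : Symm M₂
      psd₁          : PSD M₁
      psd₂          : PSD M₂
      supp₁         : Supp U M₁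
      zero-row₂     : ∀ i → (∀ j → M i j ≈ 0#) → ∀ j → M₂ i j ≈ 0#

  open Splitting

  -- Symmetric Gaussian elimination at the indices in L: M₁ collects the rank-one
  -- matrices that are split off, M₂ is the remaining Schur complement.
  eliminate : ∀ {n} (U : Subset n) (L : List (Fin n)) {M : Matrix n} → Symm M → PSD M →
              (∀ {a} → a ∈ₗ L → ∀ j → j ∉ U → M a j ≈ 0#) →
              ∃ λ (s : Splitting U M) → ∀ {a} → a ∈ₗ L → ∀ j → M₂ s a j ≈ 0#
  eliminate U [] {M} symM psdM _ = record
    { M₁        = λ _ _ → 0#
    ; M₂        = M
    ; M≋M₁⊞M₂   = λ i j → sym (+-identityˡ _)
    ; symm₁     = λ _ _ → refl
    ; symm₂     = symM
    ; psd₁      = PSD-zero λ _ _ → refl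
    ; psd₂      = psdM
    ; supp₁     = λ _ _ _ → refl
    ; zero-row₂ = λ _ row≈0 → row≈0
    } , λ ()
  eliminate U (a ∷ L) {M} symM psdM L-inside
    with c , 0≤c , psdN , rowN≈0 ← pivot symM psdM a
    with s , s-zero ← eliminate U L {residual c a M} (residual-symm c a symM) psdN
      -- For j outside U the entry `M a j` is zero, so the pivot at a causes no fill-in in column j.
      (λ b∈L j j∉U → residual-zero c a M (L-inside (there b∈L) j j∉U)
        (trans (*-congˡ (L-inside (here ≡.refl) j j∉U)) (zeroʳ _)))
    = record
    { M₁        = rankOne c (M a) ⊞ M₁ s
    ; M₂        = M₂ s
    ; M≋M₁⊞M₂   = λ i j → trans (rankOne⊞residual c a M i j)
                    (trans (+-congˡ (M≋M₁⊞M₂ s i j)) (sym (+-assoc _ _ _)))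
    ; symm₁     = λ i j → +-cong (rankOne-symm c (M a) i j) (symm₁ s i j)
    ; symm₂     = symm₂ s
    ; psd₁      = PSD-⊞ (rankOne-PSD (M a) 0≤c) (psd₁ s)
    ; psd₂      = psd₂ s
    ; supp₁     = λ i j i∉U → trans
                    (+-cong (trans (*-congˡ (trans (*-congʳ (L-inside (here ≡.refl) i i∉U)) (zeroˡ _)))
                                   (zeroʳ c))
                            (supp₁ s i j i∉U))
                    (+-identityˡ 0#)
    ; zero-row₂ = λ i row≈0 → zero-row₂ s i λ j → residual-zero c a M (row≈0 j)
                    (trans (*-congʳ (trans (symM a i) (row≈0 a))) (zeroˡ _))
    -- Row a is cleared by its own pivot and is kept at zero by the later ones.
    } , λ { (here ≡.refl) → zero-row₂ s a rowN≈0 ; (there b∈L) → s-zero b∈L }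

  -- Principal submatrices and padding by zeros.

  restrict : ∀ {n} (U : Subset n) → Matrix n → Matrix ∣ U ∣
  restrict U M i j = M (enum U i) (enum U j)

  extend : ∀ {n} (U : Subset n) → Vector Carrier ∣ U ∣ → Vector Carrier n
  extend (outside ∷ U) y zero    = 0#
  extend (outside ∷ U) y (suc i) = extend U y i
  extend (inside  ∷ U) y zero    = y zero
  extend (inside  ∷ U) y (suc i) = extend U (y ∘ suc) i

  extend-∉ : ∀ {n} (U : Subset n) y {i} → i ∉ U → extend U y i ≈ 0#
  extend-∉ (outside ∷ U) y {zero}  _  = refl
  extend-∉ (outside ∷ U) y {suc i} i∉ = extend-∉ U y (i∉ ∘ there)
  extend-∉ (inside  ∷ U) y {zero}  i∉ = contradiction here i∉
  extend-∉ (inside  ∷ U) y {suc i} i∉ = extend-∉ U (y ∘ suc) (i∉ ∘ there)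

  extend-enum : ∀ {n} (U : Subset n) y i → extend U y (enum U i) ≈ y i
  extend-enum (outside ∷ U) y i       = extend-enum U y i
  extend-enum (inside  ∷ U) y zero    = refl
  extend-enum (inside  ∷ U) y (suc i) = extend-enum U (y ∘ suc) i

  -- The hypothesis concerns whole terms, so it covers both a vector vanishing outside U and a
  -- matrix vanishing outside U.
  quadratic-enum : ∀ {n} (U : Subset n) (M : Matrix n) x →
                   (∀ i j → i ∉ U ⊎ j ∉ U → x i * M i j * x j ≈ 0#) →
                   quadratic M x ≈ quadratic (restrict U M) (x ∘ enum U)
  quadratic-enum U M x term≈0 = trans
    (sum-cong λ i → sum-enum U (λ j → x i * M i j * x j) λ j j∉ → term≈0 i j (inj₂ j∉))
    (sum-enum U (λ i → sum λ j → x i * M i (enum U j) * x (enum U j))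
      λ i i∉ → sum-zero λ j → term≈0 i (enum U j) (inj₁ i∉))

  restrict-PSD : ∀ {n} (U : Subset n) {M : Matrix n} → PSD M → PSD (restrict U M)
  restrict-PSD U {M} psdM y = 0≤-resp-≈
    (trans (quadratic-enum U M x term≈0)
      (sum-cong λ i → sum-cong λ j → *-cong (*-congʳ (extend-enum U y i)) (extend-enum U y j)))
    (psdM x)
    where
    x : Vector Carrier _
    x = extend U y
    term≈0 : ∀ i j → i ∉ U ⊎ j ∉ U → x i * M i j * x j ≈ 0#
    term≈0 i j (inj₁ i∉) =
      trans (*-congʳ (trans (*-congʳ (extend-∉ U y i∉)) (zeroˡ _))) (zeroˡ _)
    term≈0 i j (inj₂ j∉) = trans (*-congˡ (extend-∉ U y j∉)) (zeroʳ _)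

  restrict-PSD⁻ : ∀ {n} (U : Subset n) {M : Matrix n} →
                  (∀ i j → i ∉ U ⊎ j ∉ U → M i j ≈ 0#) → PSD (restrict U M) → PSD M
  restrict-PSD⁻ U {M} M≈0 psdU x = 0≤-resp-≈ (sym (quadratic-enum U M x λ i j ∉U →
    trans (*-congʳ (trans (*-congˡ (M≈0 i j ∉U)) (zeroʳ _))) (zeroˡ _))) (psdU (x ∘ enum U))

  Supp⇒≈0 : ∀ {n} {U : Subset n} {M : Matrix n} → Symm M → Supp U M →
            ∀ i j → i ∉ U ⊎ j ∉ U → M i j ≈ 0#
  Supp⇒≈0 symM suppM i j (inj₁ i∉) = suppM i j i∉
  Supp⇒≈0 symM suppM i j (inj₂ j∉) = trans (symM i j) (suppM j i j∉)

  restrict-𝒫 : ∀ {n} {G : Graph n} (U : Subset n) {M} → 𝒫 G M → 𝒫 (G [ U ]ᴳ) (restrict U M)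
  restrict-𝒫 U {M} p = record
    { symmetric = λ i j → 𝒫.symmetric p _ _
    ; psd       = restrict-PSD U {M} (𝒫.psd p)
    ; sparse    = λ i j i≢j → 𝒫.sparse p _ _ (i≢j ∘ enum-injective U)
    }

  -- Entrywise functions and padded matrices.

  module _ (f : RealFunction) (f0≈0 : Func.to f 0# ≈ 0#) where

    open Func f using () renaming (to to f⟨_⟩; cong to f-cong)

    f-zero : ∀ {x} → x ≈ 0# → f⟨ x ⟩ ≈ 0#
    f-zero x≈0 = trans (f-cong x≈0) f0≈0

    -- Preservation on 𝒫_{G_U}, with the matrices of order |U| padded by zeros to order n.
    PreservesOn : ∀ {n} → Graph n → Subset n → Set (c ⊔ ℓ₁ ⊔ ℓ₂)
    PreservesOn G U = ∀ {M} → 𝒫 G M → Supp U M → PSD (f [ M ])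

    preservesOn : ∀ {n} {G : Graph n} (U : Subset n) →
                  PreservesPositivity f (G [ U ]ᴳ) → PreservesOn G U
    preservesOn U pres {M} p suppM = restrict-PSD⁻ U {f [ M ]}
      (λ i j ∉U → f-zero (Supp⇒≈0 {M = M} (𝒫.symmetric p) suppM i j ∉U))
      (𝒫.psd (pres _ (restrict-𝒫 U p)))

    preservesPositivity : ∀ {n} {G : Graph n} → PreservesOn G ⊤ → PreservesPositivity f G
    preservesPositivity pres M p = record
      { symmetric = λ i j → f-cong (𝒫.symmetric p i j)
      ; psd       = pres p λ _ _ i∉⊤ → contradiction ∈⊤ i∉⊤
      ; sparse    = λ i j i≢j ¬ij → f-zero (𝒫.sparse p i j i≢j ¬ij)
      }

    defect : ∀ {n} → Matrix n → Matrix n → Matrix n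
    defect M N = f [ M ⊞ N ] ⊟ f [ M ] ⊟ f [ N ]

    -- If one argument is zero, f(0) = 0 removes its term and the remaining two cancel.
    defect-zero : ∀ x y → x ≈ 0# ⊎ y ≈ 0# → f⟨ x + y ⟩ - f⟨ x ⟩ - f⟨ y ⟩ ≈ 0#
    defect-zero x y (inj₁ x≈0) = trans
      (+-congʳ (trans
        (+-cong (f-cong (trans (+-congʳ x≈0) (+-identityˡ y))) (trans (-‿cong (f-zero x≈0)) -0#≈0#))
        (+-identityʳ _)))
      (-‿inverseʳ _)
    defect-zero x y (inj₂ y≈0) = trans
      (+-cong
        (trans (+-congʳ (f-cong (trans (+-congˡ y≈0) (+-identityʳ x)))) (-‿inverseʳ _))
        (trans (-‿cong (f-zero y≈0)) -0#≈0#))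
      (+-identityˡ 0#)

    f-⊞ : ∀ {n} (M N : Matrix n) → f [ M ] ⊞ f [ N ] ⊞ defect M N ≋ f [ M ⊞ N ]
    f-⊞ M N i j = begin
      y + z + (x + - y + - z)
        ≈⟨ solve 5 (λ x y z y′ z′ → y :+ z :+ (x :+ y′ :+ z′) := (y :+ y′) :+ (z :+ z′) :+ x)
                 refl x y z (- y) (- z) ⟩
      (y + - y) + (z + - z) + x   ≈⟨ +-congʳ (+-cong (-‿inverseʳ y) (-‿inverseʳ z)) ⟩
      0# + 0# + x                 ≈⟨ trans (+-congʳ (+-identityˡ 0#)) (+-identityˡ x) ⟩
      x                           ∎
      where
      x y z : Carrier
      x = f⟨ M i j + N i j ⟩
      y = f⟨ M i j ⟩
      z = f⟨ N i j ⟩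

    -- Gluing two vertex sets along a complete intersection.

    module _ {n s} {G : Graph n} {U V : Subset n}
             (separated : ∀ {u v} → u ∈ U → u ∉ V → v ∈ V → v ∉ U → ¬ Adj G u v)
             (complete  : ∀ {u v} → u ∈ U ∩ V → v ∈ U ∩ V → u ≢ v → Adj G u v)
             (∣U∩V∣≤s   : ∣ U ∩ V ∣ ℕ.≤ s)
             (s≤n       : s ℕ.≤ n)
             (super     : SuperAdditive f (K s))
             where

      module _ {M : Matrix n} (p : 𝒫 G M) (suppM : Supp (U ∪ V) M) where
        open 𝒫 p

        ∈U∖V? : ∀ a → Dec (a ∈ U × a ∉ V)
        ∈U∖V? a = (a ∈? U) ×-dec ¬? (a ∈? V)

        eliminated : List (Fin n)
        eliminated = filter ∈U∖V? (allFin n)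

        -- A column j in V but not in U is excluded by separation, and a column outside both sets by
        -- the support of M.
        eliminated-inside : ∀ {a} → a ∈ₗ eliminated → ∀ j → j ∉ U → M a j ≈ 0#
        eliminated-inside {a} a∈ j j∉U with ∈-filter⁻ ∈U∖V? {xs = allFin n} a∈
        ... | _ , a∈U , a∉V with j ∈? V
        ...   | yes j∈V = sparse a j (λ { ≡.refl → j∉U a∈U }) (separated a∈U a∉V j∈V j∉U)
        ...   | no  j∉V = trans (symmetric a j)
                  (suppM j a ([ j∉U , j∉V ] ∘ x∈p∪q⁻ U V))

        elimination : ∃ λ (s : Splitting U M) → ∀ {a} → a ∈ₗ eliminated → ∀ j → M₂ s a j ≈ 0#
        elimination = eliminate U eliminated symmetric psd eliminated-inside

        open Splitting (proj₁ elimination)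
          renaming (M₁ to N₁; M₂ to N₂; M≋M₁⊞M₂ to M≋N₁⊞N₂; symm₁ to symmN₁; symm₂ to symmN₂;
                    psd₁ to psdN₁; psd₂ to psdN₂; supp₁ to suppN₁; zero-row₂ to zero-rowN₂)

        -- A row in U but not in V has been eliminated. A row outside both sets was zero in M, and
        -- elimination preserves zero rows.
        suppN₂ : Supp V N₂
        suppN₂ i j i∉V with i ∈? U
        ... | yes i∈U = proj₂ elimination (∈-filter⁺ ∈U∖V? (∈-allFin i) (i∈U , i∉V)) j
        ... | no  i∉U = zero-rowN₂ i (λ j → suppM i j ([ i∉U , i∉V ] ∘ x∈p∪q⁻ U V)) j

        one-zero : ∀ i j → i ∉ U ∩ V ⊎ j ∉ U ∩ V → N₁ i j ≈ 0# ⊎ N₂ i j ≈ 0#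
        one-zero i j (inj₁ i∉) with i ∈? U | i ∈? V
        ... | no  i∉U | _       = inj₁ (suppN₁ i j i∉U)
        ... | yes _   | no  i∉V = inj₂ (suppN₂ i j i∉V)
        ... | yes i∈U | yes i∈V = contradiction (x∈p∩q⁺ (i∈U , i∈V)) i∉
        one-zero i j (inj₂ j∉) with one-zero j i (inj₁ j∉)
        ... | inj₁ N₁ji≈0 = inj₁ (trans (symmN₁ i j) N₁ji≈0)
        ... | inj₂ N₂ji≈0 = inj₂ (trans (symmN₂ i j) N₂ji≈0)

        -- Two distinct vertices of the intersection are adjacent, so at a non-edge one summand
        -- vanishes by its support. The other then equals the entry of M, which is zero.
        both-sparse : ∀ i j → i ≢ j → ¬ Adj G i j → N₁ i j ≈ 0# × N₂ i j ≈ 0#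
        both-sparse i j i≢j ¬ij with one
          where
          one : N₁ i j ≈ 0# ⊎ N₂ i j ≈ 0#
          one with i ∈? U ∩ V | j ∈? U ∩ V
          ... | no  i∉ | _      = one-zero i j (inj₁ i∉)
          ... | yes _  | no  j∉ = one-zero i j (inj₂ j∉)
          ... | yes i∈ | yes j∈ = contradiction (complete i∈ j∈ i≢j) ¬ij
        ... | inj₁ N₁≈0 = N₁≈0 , trans
                (sym (trans (M≋N₁⊞N₂ i j) (trans (+-congʳ N₁≈0) (+-identityˡ _))))
                (sparse i j i≢j ¬ij)
        ... | inj₂ N₂≈0 = trans
                (sym (trans (M≋N₁⊞N₂ i j) (trans (+-congˡ N₂≈0) (+-identityʳ _))))
                (sparse i j i≢j ¬ij) , N₂≈0

        N₁∈𝒫 : 𝒫 G N₁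
        N₁∈𝒫 = record
          { symmetric = symmN₁ ; psd = psdN₁
          ; sparse = λ i j i≢j ¬ij → proj₁ (both-sparse i j i≢j ¬ij) }

        N₂∈𝒫 : 𝒫 G N₂
        N₂∈𝒫 = record
          { symmetric = symmN₂ ; psd = psdN₂
          ; sparse = λ i j i≢j ¬ij → proj₂ (both-sparse i j i≢j ¬ij) }

        K-𝒫 : ∀ {W : Subset n} {N} → Symm N → PSD N → 𝒫 (K ∣ W ∣) (restrict W N)
        K-𝒫 {W} {N} symN psdN = record
          { symmetric = λ i j → symN _ _
          ; psd       = restrict-PSD W {N} psdN
          ; sparse    = λ i j i≢j ¬i≢j → contradiction i≢j ¬i≢j
          }

        -- The defect vanishes outside the intersection, hence outside the larger set W of exactly s
        -- vertices. On W superadditivity applies, since the cone of a complete graph imposes no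
        -- zeros.
        defect-PSD : PSD (defect N₁ N₂)
        defect-PSD with W , U∩V⊆W , ∣W∣≡s ← superset (U ∩ V) ∣U∩V∣≤s s≤n =
          restrict-PSD⁻ W {defect N₁ N₂}
            (λ i j ∉W → defect-zero (N₁ i j) (N₂ i j) (one-zero i j
              ([ (λ i∉ → inj₁ (i∉ ∘ U∩V⊆W)) , (λ j∉ → inj₂ (j∉ ∘ U∩V⊆W)) ] ∉W)))
            (𝒫.psd (≡.subst (SuperAdditive f ∘ K) (≡.sym ∣W∣≡s) super
              (restrict W N₁) (restrict W N₂)
              (K-𝒫 {W} {N₁} symmN₁ psdN₁) (K-𝒫 {W} {N₂} symmN₂ psdN₂)))

        glue-PSD : PreservesOn G U → PreservesOn G V → PSD (f [ M ])
        glue-PSD presU presV = PSD-resp-≋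
          (λ i j → trans (f-⊞ N₁ N₂ i j) (f-cong (sym (M≋N₁⊞N₂ i j))))
          (PSD-⊞ (PSD-⊞ (presU N₁∈𝒫 suppN₁) (presV N₂∈𝒫 suppN₂)) defect-PSD)

      preservesOn-∪ : PreservesOn G U → PreservesOn G V → PreservesOn G (U ∪ V)
      preservesOn-∪ presU presV p suppM = glue-PSD p suppM presU presV

    -- Induction along the perfect ordering.

    -- The index m is a natural number, not an element of `Fin k`, so that the union of all
    -- components, m = k, is included.
    preservesOn-H : ∀ {n k} {G : Graph n} {B : Vector (Subset n) k} →
      PerfectOrdering G B → (∀ {u v} → Adj G u v → ∃ λ l → u ∈ B l × v ∈ B l) →
      (∀ i → PreservesPositivity f (G [ B i ]ᴳ)) → SuperAdditive f (K (maxSeparatorSize B)) →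
      ∀ m → m ℕ.≤ k → PreservesOn G (H B m)
    -- The empty union supports only the zero matrix, which f maps to itself entrywise.
    preservesOn-H po edge pres super ℕ.zero _ p suppM = PSD-zero λ i j → f-zero (suppM i j ∉⊥)
    preservesOn-H {G = G} {B} po edge pres super (ℕ.suc m) m<k p suppM =
      -- Indices start from zero, so the set added to `H B m` is the one with index m. Its
      -- intersection with that union is by definition `S B i`.
      preservesOn-∪ (S-separates po edge i)
        (Complete⇒Adj G (S B i) (PerfectOrdering.S-complete po i))
        (∣S∣≤maxSeparatorSize B i) (maxSeparatorSize≤n B) super
        (≡.subst (PreservesOn G ∘ H B) (≡.sym i≡m)
          (preservesOn-H po edge pres super m (ℕ.<⇒≤ m<k)))
        (preservesOn (B i) (pres i))
        p λ u v u∉ → suppM u v (u∉ ∘ H-suc B i ∘ ≡.subst (λ l → u ∈ H B (ℕ.suc l)) (≡.sym i≡m))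
      where
      i = fromℕ< m<k
      i≡m : toℕ i ≡ m
      i≡m = toℕ-fromℕ< m<k

theorem4p1 : ∀ {c ℓ₁ ℓ₂} (ℝ : CompleteOrderedField c ℓ₁ ℓ₂) →
    let open CompleteOrderedField ℝ
        open Entrywise ℝ
    in
    ∀ (n k : ℕ) (G : Graph n) (B : Vector (Subset n) k) →
    EnumeratesPrimeComponents G B →
    PerfectOrdering G B →
    (f : RealFunction) →
    Func.to f 0# ≈ 0# →
    (∀ (i : Fin k) → PreservesPositivity f (G [ B i ]ᴳ)) →
    SuperAdditive f (K (maxSeparatorSize B)) →
    PreservesPositivity f G
theorem4p1 ℝ n k G B (L , components , _ , listed) po f f0≈0 pres super =
  preservesPositivity ℝ f f0≈0 λ p suppM →
    preservesOn-H ℝ f f0≈0 po (λ uv → covered (inj₂ uv)) pres super k ℕ.≤-refl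
      p λ i j i∉H → contradiction (vertex∈H i) i∉H
  where
  covered : ∀ {u v} → EqualOrAdjacent G u v → ∃ λ l → u ∈ B l × v ∈ B l
  covered uv with components-cover components uv
  ... | U , U∈L , u∈U , v∈U with Equivalence.to (listed U) U∈L
  ...   | l , ≡.refl = l , u∈U , v∈U

  -- The reflexive case of `EqualOrAdjacent` puts even an isolated vertex into some component, so
  -- support in `H B k` restricts nothing.
  vertex∈H : ∀ i → i ∈ H B k
  vertex∈H i with l , i∈l , _ ← covered (inj₁ ≡.refl) = ∈-H⁺ B l (toℕ<n l) i∈l
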